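{- As formal power series, $\hat{E}(q,x,y)=F(q,1,x,y)$, where $\hat E(q,x,y)=1+\sum_{n\ge1}\sum_{k=1}^{n}\hat{E}_{k,n}(q)\,y^k x^n$.
   Context: Let $[k]_q=1+q+\cdots+q^{k-1}$ (with $[0]_q=0$), and for $n\ge1$, $1\le k\le n$ let $$\hat{E}_{k,n}(q)=q^{k-k^2}\sum_{i=0}^{k-1}(-1)^i [k-i]_q^n\, q^{k(i-1)}\left( \binom{n}{i}q^{k-i}+\binom{n}{i-1}\right),$$ with the convention $\binom{n}{ -1}=0$. Let $[0]_{p,q}=0$, $[n]_{p,q}=p^{n-1}+p^{n-2}q+\cdots+q^{n-1}$ for $n\ge 1$ (so $[n]_{1,q}=[n]_q$), $b_n=y[n+1]_{p,q}+[n]_{p,q}$, $\lambda_n=y[n]_{p,q}^2$, and let $F(q,p,x,y)$ be the continued fraction $$F=\cfrac{1}{1-b_0x-\cfrac{\lambda_1x^2}{1-b_1x-\cfrac{\lambda_2x^2}{1-b_2x-\cdots}}}.$$ -}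

module Defs where

open import Level using (Level)
open import Algebra.Bundles using (CommutativeRing)
open import Data.Nat using (ℕ; zero; suc; _∸_) renaming (_*_ to _*ℕ_)
open import Data.Nat.Combinatorics using (_C_)
open import Data.Integer using (ℤ; +_; -[1+_]) renaming (_-_ to _-ℤ_)

-- Everything is developed over an arbitrary commutative ring R.
-- Formal power series in x with coefficients in R are functions ℕ → Carrier
-- (the n-th value is the coefficient of x^n).
module Series {c ℓ : Level} (R : CommutativeRing c ℓ) where
  open CommutativeRing R

  sumTo : ℕ → (ℕ → Carrier) → Carrier
  sumTo zero    f = 0#
  sumTo (suc n) f = sumTo n f + f n

  _^^_ : Carrier → ℕ → Carrier
  a ^^ zero  = 1#
  a ^^ suc n = a * (a ^^ n)

  fromℕ : ℕ → Carrier
  fromℕ zero    = 0#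
  fromℕ (suc n) = 1# + fromℕ n

  -- integer powers of q, given a two-sided inverse qi of q (q * qi ≈ 1#)
  zpow : Carrier → Carrier → ℤ → Carrier
  zpow q qi (+ n)      = q ^^ n
  zpow q qi -[1+ n ]   = qi ^^ suc n

  pqint : Carrier → Carrier → ℕ → Carrier
  pqint p q n = sumTo n (λ i → (p ^^ (n ∸ suc i)) * (q ^^ i))

  qint : Carrier → ℕ → Carrier
  qint q n = pqint 1# q n

  Series : Set c
  Series = ℕ → Carrier

  one : Series
  one zero    = 1#
  one (suc _) = 0#

  _⊛_ : Series → Series → Series
  (f ⊛ g) n = sumTo (suc n) (λ i → f i * g (n ∸ i))

  pow : Series → ℕ → Series
  pow h zero    = one
  pow h (suc k) = h ⊛ pow h k

  -- 1/(1 - h) = Σ_k h^k, for a series h with zero constant term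
  -- (only the powers h^0..h^n contribute to the coefficient of x^n)
  geom : Series → Series
  geom h n = sumTo (suc n) (λ k → pow h k n)

  bcf : Carrier → Carrier → Carrier → ℕ → Carrier
  bcf p q y n = y * pqint p q (suc n) + pqint p q n

  lcf : Carrier → Carrier → Carrier → ℕ → Carrier
  lcf p q y n = y * (pqint p q n * pqint p q n)

  denomTail : Carrier → Carrier → Carrier → ℕ → Series → Series
  denomTail p q y j T zero          = 0#
  denomTail p q y j T (suc zero)    = bcf p q y j
  denomTail p q y j T (suc (suc m)) = lcf p q y (suc j) * T m

  cfTrunc : Carrier → Carrier → Carrier → ℕ → ℕ → Series
  cfTrunc p q y j zero    = one
  cfTrunc p q y j (suc d) = geom (denomTail p q y j (cfTrunc p q y (suc j) d))

  -- the continued fraction F(q,p,x,y) as a formal power series in x: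
  -- its x^n coefficient is that of the truncation of depth n+1
  -- (truncations of depth d agree with F up to x^(2d-1)).
  Fcf : Carrier → Carrier → Carrier → Series
  Fcf q p y n = cfTrunc p q y 0 (suc n) n

  binomPrev : ℕ → ℕ → Carrier
  binomPrev n zero    = 0#
  binomPrev n (suc i) = fromℕ (n C i)

  Ehat : Carrier → Carrier → ℕ → ℕ → Carrier
  Ehat q qi k n =
    zpow q qi ((+ k) -ℤ (+ (k *ℕ k))) *
    sumTo k (λ i →
      ((- 1#) ^^ i) * ((qint q (k ∸ i) ^^ n) *
      (zpow q qi ((+ (k *ℕ i)) -ℤ (+ k)) *
      ((fromℕ (n C i) * (q ^^ (k ∸ i))) + binomPrev n i))))

  EhatSeries : Carrier → Carrier → Carrier → Series
  EhatSeries q qi y zero    = 1#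
  EhatSeries q qi y (suc m) =
    sumTo (suc m) (λ k' → Ehat q qi (suc k') (suc m) * (y ^^ suc k'))

{-# OPTIONS --safe #-}

-- Substituting m = k - i turns Ê(q,x,y) into the moment generating function Σ_n L(X^n) x^n of the
-- functional L = Σ_m q^{-m²} y^m (q^m - y q^{-m}) δ_{x_m} supported at x_m = [m](1 - y q^{-m}).
-- Its orthogonal polynomials have values
--   P_j(x_m) = Σ_i c_{j,i} (y q^{-m})^i [m+i][m+i-1]⋯[m+i-j+1],   Σ_i c_{j,i} z^i = Π_{l<j} (q^l - z):
-- they satisfy X P_j = P_{j+1} + b_j P_j + λ_j P_{j-1}, and L(P_j) = 0 for j ≥ 1 because
-- Π_{l<j} (q^l - q^t) is proportional to [t][t-1]⋯[t-j+1].  Hence L(X^n P_j) obeys the recurrence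
-- of the weighted Motzkin paths counted by the continued fraction.

module Submission where

open import Defs
open import Level using (Level)
open import Algebra.Bundles using (CommutativeRing)
open import Algebra.Solver.Ring.AlmostCommutativeRing using (_-Raw-AlmostCommutative⟶_; Induced-equivalence; fromCommutativeRing)
import Algebra.Solver.Ring as RingSolver
open import Data.Integer as ℤ using (ℤ; +_; -[1+_]; _⊖_)
import Data.Integer.Properties as ℤₚ
open import Data.Maybe using (just; nothing)
open import Data.Nat as ℕ using (ℕ; zero; suc; pred; _∸_; _<_; _≤_; s≤s)
open import Data.Nat.Combinatorics using (nCk+nC[k+1]≡[n+1]C[k+1]) renaming (_C_ to choose)
import Data.Nat.Properties as ℕₚ
open import Data.Sign as Sign using (Sign)
open import Data.Sum using (inj₁; inj₂)
open import Function using (_∘_)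
open import Relation.Binary.Definitions using (WeaklyDecidable)
import Relation.Binary.PropositionalEquality as ≡
open ≡ using (_≡_)
open import Relation.Nullary using (yes; no)

-- The support x_0, x_1, ... is infinite and `y` is an arbitrary ring element, so `L` cannot be
-- summed in the ring itself. The variable y is therefore kept formal: a function on the support is
-- stored through its coefficients of y^i at x_m, and as the mass at x_m carries y^m, the
-- coefficient of y^k in L(f) is a finite sum over m + i = k. The ring element `y` is substituted
-- only once each moment is known to be a polynomial in y (`moment-degree`). Neither 1 - q nor a
-- q-integer may be divided by. The facts about falling products are therefore stated multiplied
-- out, and L(P_j) = 0 appears as the difference of two equal products, so nothing has to be
-- cancelled and q = 1 is covered as well.

-- The abstract ring has no decidable equality, so its own elements cannot serve as solver
-- coefficients; integer coefficients let the solver cancel terms.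
module IntegerCoefficients {c ℓ : Level} (R : CommutativeRing c ℓ) where
  open CommutativeRing R
  open import Algebra.Properties.Semiring.Mult.TCOptimised semiring
  open import Algebra.Properties.AbelianGroup +-abelianGroup using (ε⁻¹≈ε; ⁻¹-involutive; ∙-cancelʳ; ⁻¹-∙-comm)
  open import Algebra.Properties.Ring ring using (-‿distribˡ-*; -‿distribʳ-*)
  open import Relation.Binary.Reasoning.Setoid setoid

  ⟦_⟧ℤ : ℤ → Carrier
  ⟦ + n ⟧ℤ      = n × 1#
  ⟦ -[1+ n ] ⟧ℤ = - (suc n × 1#)

  private
    minus-+ : ∀ n → ⟦ ℤ.- (+ n) ⟧ℤ ≈ - (n × 1#)
    minus-+ zero    = sym ε⁻¹≈ε
    minus-+ (suc n) = refl

    cancel-one : ∀ x y → (1# + x) - (1# + y) ≈ x - y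
    cancel-one x y = begin
      (1# + x) - (1# + y)         ≈⟨ +-cong (+-comm 1# x) (sym (⁻¹-∙-comm 1# y)) ⟩
      (x + 1#) + (- 1# - y)       ≈⟨ +-assoc x 1# _ ⟩
      x + (1# + (- 1# - y))       ≈⟨ +-congˡ (+-assoc 1# (- 1#) (- y)) ⟨
      x + ((1# - 1#) - y)         ≈⟨ +-congˡ (+-congʳ (-‿inverseʳ 1#)) ⟩
      x + (0# - y)                ≈⟨ +-congˡ (+-identityˡ (- y)) ⟩
      x - y                       ∎

    ⟦⊖⟧ : ∀ m n → ⟦ m ⊖ n ⟧ℤ ≈ m × 1# - n × 1#
    ⟦⊖⟧ m zero = sym (trans (+-congˡ ε⁻¹≈ε) (+-identityʳ _))
    ⟦⊖⟧ zero (suc n) = sym (+-identityˡ _)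
    ⟦⊖⟧ (suc m) (suc n) = begin
      ⟦ suc m ⊖ suc n ⟧ℤ               ≡⟨ ≡.cong ⟦_⟧ℤ (ℤₚ.[1+m]⊖[1+n]≡m⊖n m n) ⟩
      ⟦ m ⊖ n ⟧ℤ                       ≈⟨ ⟦⊖⟧ m n ⟩
      m × 1# - n × 1#                  ≈⟨ cancel-one _ _ ⟨
      (1# + m × 1#) - (1# + n × 1#)    ≈⟨ +-cong (1+× m 1#) (-‿cong (1+× n 1#)) ⟨
      suc m × 1# - suc n × 1#          ∎

    +-homo : ∀ i j → ⟦ i ℤ.+ j ⟧ℤ ≈ ⟦ i ⟧ℤ + ⟦ j ⟧ℤ
    +-homo (+ m) (+ n)           = ×-homo-+ 1# m n
    +-homo (+ m) -[1+ n ]        = ⟦⊖⟧ m (suc n)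
    +-homo -[1+ m ] (+ n)        = trans (⟦⊖⟧ n (suc m)) (+-comm _ _)
    +-homo -[1+ m ] -[1+ n ] = begin
      - ((suc (suc m ℕ.+ n)) × 1#)    ≡⟨ ≡.cong (λ k → - (suc k × 1#)) (≡.sym (ℕₚ.+-suc m n)) ⟩
      - ((suc m ℕ.+ suc n) × 1#)      ≈⟨ -‿cong (×-homo-+ 1# (suc m) (suc n)) ⟩
      - (suc m × 1# + suc n × 1#)     ≈⟨ ⁻¹-∙-comm _ _ ⟨
      - (suc m × 1#) - suc n × 1#     ∎

    ⟦-◃⟧ : ∀ n → ⟦ Sign.- ℤ.◃ n ⟧ℤ ≈ - (n × 1#)
    ⟦-◃⟧ zero    = sym ε⁻¹≈ε
    ⟦-◃⟧ (suc n) = refl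

    ⟦+◃⟧ : ∀ n → ⟦ Sign.+ ℤ.◃ n ⟧ℤ ≈ n × 1#
    ⟦+◃⟧ n = reflexive (≡.cong ⟦_⟧ℤ (ℤₚ.+◃n≡+n n))

    *-homo : ∀ i j → ⟦ i ℤ.* j ⟧ℤ ≈ ⟦ i ⟧ℤ * ⟦ j ⟧ℤ
    *-homo (+ m) (+ n)    = trans (⟦+◃⟧ (m ℕ.* n)) (×1-homo-* m n)
    *-homo (+ m) -[1+ n ] = begin
      ⟦ Sign.- ℤ.◃ (m ℕ.* suc n) ⟧ℤ  ≈⟨ ⟦-◃⟧ (m ℕ.* suc n) ⟩
      - ((m ℕ.* suc n) × 1#)         ≈⟨ -‿cong (×1-homo-* m (suc n)) ⟩
      - (m × 1# * (suc n × 1#))      ≈⟨ -‿distribʳ-* _ _ ⟩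
      m × 1# * - (suc n × 1#)        ∎
    *-homo -[1+ m ] (+ n) = begin
      ⟦ Sign.- ℤ.◃ (suc m ℕ.* n) ⟧ℤ  ≈⟨ ⟦-◃⟧ (suc m ℕ.* n) ⟩
      - ((suc m ℕ.* n) × 1#)         ≈⟨ -‿cong (×1-homo-* (suc m) n) ⟩
      - (suc m × 1# * (n × 1#))      ≈⟨ -‿distribˡ-* _ _ ⟩
      - (suc m × 1#) * (n × 1#)      ∎
    *-homo -[1+ m ] -[1+ n ] = begin
      (suc m ℕ.* suc n) × 1#             ≈⟨ ×1-homo-* (suc m) (suc n) ⟩
      suc m × 1# * (suc n × 1#)          ≈⟨ ⁻¹-involutive _ ⟨
      - - (suc m × 1# * (suc n × 1#))    ≈⟨ -‿cong (-‿distribˡ-* _ _) ⟩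
      - (- (suc m × 1#) * (suc n × 1#))  ≈⟨ -‿distribʳ-* _ _ ⟩
      - (suc m × 1#) * - (suc n × 1#)    ∎

    -‿homo : ∀ i → ⟦ ℤ.- i ⟧ℤ ≈ - ⟦ i ⟧ℤ
    -‿homo (+ n)    = minus-+ n
    -‿homo -[1+ n ] = sym (⁻¹-involutive _)

    morphism : ℤ.+-*-rawRing -Raw-AlmostCommutative⟶ fromCommutativeRing R
    morphism = record
      { ⟦_⟧    = ⟦_⟧ℤ
      ; +-homo = +-homo
      ; *-homo = *-homo
      ; -‿homo = -‿homo
      ; 0-homo = refl
      ; 1-homo = refl
      }

    _coeff≟_ : WeaklyDecidable (Induced-equivalence morphism)
    i coeff≟ j with i ℤ.≟ j
    ... | yes i≡j = just (reflexive (≡.cong ⟦_⟧ℤ i≡j))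
    ... | no  _   = nothing

  -- Proves x ≈ y as a linear consequence of e ≈ e′.
  by-relation : ∀ {x y e e′} → e ≈ e′ → x + e ≈ y + e′ → x ≈ y
  by-relation {x} {y} e≈e′ p = ∙-cancelʳ _ x y (trans p (+-congˡ (sym e≈e′)))

  open RingSolver ℤ.+-*-rawRing (fromCommutativeRing R) morphism _coeff≟_ public

-- Finite sums.

module FiniteSums {c ℓ : Level} (R : CommutativeRing c ℓ) where
  open CommutativeRing R
  open Series R
  open IntegerCoefficients R
  open import Relation.Binary.Reasoning.Setoid setoid

  sumTo-cong< : ∀ n {f g} → (∀ i → i < n → f i ≈ g i) → sumTo n f ≈ sumTo n g
  sumTo-cong< zero    f≈g = refl
  sumTo-cong< (suc n) f≈g =
    +-cong (sumTo-cong< n (λ i i<n → f≈g i (ℕₚ.m<n⇒m<1+n i<n))) (f≈g n (ℕₚ.n<1+n n))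

  sumTo-cong : ∀ n {f g} → (∀ i → f i ≈ g i) → sumTo n f ≈ sumTo n g
  sumTo-cong n f≈g = sumTo-cong< n (λ i _ → f≈g i)

  sumTo-zero< : ∀ n {f} → (∀ i → i < n → f i ≈ 0#) → sumTo n f ≈ 0#
  sumTo-zero< zero    f≈0 = refl
  sumTo-zero< (suc n) f≈0 =
    trans (+-cong (sumTo-zero< n (λ i i<n → f≈0 i (ℕₚ.m<n⇒m<1+n i<n))) (f≈0 n (ℕₚ.n<1+n n)))
          (+-identityˡ 0#)

  sumTo-+ : ∀ n f g → sumTo n (λ i → f i + g i) ≈ sumTo n f + sumTo n g
  sumTo-+ zero    f g = sym (+-identityˡ 0#)
  sumTo-+ (suc n) f g = trans (+-congʳ (sumTo-+ n f g))
    (solve 4 (λ a b c d → (a :+ b) :+ (c :+ d) := (a :+ c) :+ (b :+ d)) refl _ _ _ _)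

  sumTo-*ˡ : ∀ n a f → sumTo n (λ i → a * f i) ≈ a * sumTo n f
  sumTo-*ˡ zero    a f = sym (zeroʳ a)
  sumTo-*ˡ (suc n) a f = trans (+-congʳ (sumTo-*ˡ n a f)) (sym (distribˡ a _ _))

  sumTo-head : ∀ n f → sumTo (suc n) f ≈ f 0 + sumTo n (f ∘ suc)
  sumTo-head zero    f = +-comm 0# (f 0)
  sumTo-head (suc n) f = trans (+-congʳ (sumTo-head n f)) (+-assoc _ _ _)

  -- This is the four-term shape of `recurrence`; the double factor `r` stands for the [j]² in λ_j.
  sumTo-comb : ∀ n s t r (A B C D : ℕ → Carrier) →
    sumTo n (λ i → A i + s * B i + t * C i + r * (r * D i)) ≈
    sumTo n A + s * sumTo n B + t * sumTo n C + r * (r * sumTo n D)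
  sumTo-comb zero s t r A B C D =
    solve 3 (λ s t r → con (+ 0) := con (+ 0) :+ s :* con (+ 0) :+ t :* con (+ 0) :+ r :* (r :* con (+ 0)))
      refl s t r
  sumTo-comb (suc n) s t r A B C D = trans (+-congʳ (sumTo-comb n s t r A B C D))
    (solve 11 (λ s t r a b c d a′ b′ c′ d′ →
        (a :+ s :* b :+ t :* c :+ r :* (r :* d)) :+ (a′ :+ s :* b′ :+ t :* c′ :+ r :* (r :* d′))
     := (a :+ a′) :+ s :* (b :+ b′) :+ t :* (c :+ c′) :+ r :* (r :* (d :+ d′)))
      refl s t r _ _ _ _ (A n) (B n) (C n) (D n))

-- Cauchy products and geometric series.

module Convolution {c ℓ : Level} (R : CommutativeRing c ℓ) where
  open CommutativeRing R
  open Series R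
  open FiniteSums R
  open IntegerCoefficients R
  open import Relation.Binary.Reasoning.Setoid setoid

  ⊛-suc : ∀ f g n → (f ⊛ g) (suc n) ≈ f 0 * g (suc n) + ((f ∘ suc) ⊛ g) n
  ⊛-suc f g n = sumTo-head (suc n) _

  ⊛-congˡ≤ : ∀ f {g h} n → (∀ i → i ≤ n → g i ≈ h i) → (f ⊛ g) n ≈ (f ⊛ h) n
  ⊛-congˡ≤ f n g≈h = sumTo-cong (suc n) (λ i → *-congˡ (g≈h (n ∸ i) (ℕₚ.m∸n≤m n i)))

  ⊛-congʳ : ∀ {f g} h n → (∀ i → f i ≈ g i) → (f ⊛ h) n ≈ (g ⊛ h) n
  ⊛-congʳ h n f≈g = sumTo-cong (suc n) (λ i → *-congʳ (f≈g i))

  ⊛-distribˡ : ∀ f g h n → (f ⊛ (λ i → g i + h i)) n ≈ (f ⊛ g) n + (f ⊛ h) n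
  ⊛-distribˡ f g h n =
    trans (sumTo-cong (suc n) (λ i → distribˡ (f i) _ _)) (sumTo-+ (suc n) _ _)

  ⊛-zeroʳ : ∀ f n {g} → (∀ i → i ≤ n → g i ≈ 0#) → (f ⊛ g) n ≈ 0#
  ⊛-zeroʳ f n g≈0 = sumTo-zero< (suc n)
    (λ i _ → trans (*-congˡ (g≈0 (n ∸ i) (ℕₚ.m∸n≤m n i))) (zeroʳ (f i)))

  ⊛-sumʳ : ∀ m f (g : ℕ → Series) n →
    sumTo m (λ k → (f ⊛ g k) n) ≈ (f ⊛ (λ i → sumTo m (λ k → g k i))) n
  ⊛-sumʳ zero    f g n = sym (⊛-zeroʳ f n (λ _ _ → refl))
  ⊛-sumʳ (suc m) f g n = trans (+-congʳ (⊛-sumʳ m f g n)) (sym (⊛-distribˡ f (λ i → sumTo m (λ k → g k i)) (g m) n))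

  ⊛-linˡ : ∀ a f g h n → ((λ i → a * f i + g i) ⊛ h) n ≈ a * (f ⊛ h) n + (g ⊛ h) n
  ⊛-linˡ a f g h n = begin
    sumTo (suc n) (λ i → (a * f i + g i) * h (n ∸ i))
      ≈⟨ sumTo-cong (suc n) (λ i →
           solve 4 (λ a x y z → (a :* x :+ y) :* z := a :* (x :* z) :+ y :* z) refl a (f i) (g i) (h (n ∸ i))) ⟩
    sumTo (suc n) (λ i → a * (f i * h (n ∸ i)) + g i * h (n ∸ i))
      ≈⟨ sumTo-+ (suc n) _ _ ⟩
    sumTo (suc n) (λ i → a * (f i * h (n ∸ i))) + (g ⊛ h) n
      ≈⟨ +-congʳ (sumTo-*ˡ (suc n) a _) ⟩
    a * (f ⊛ h) n + (g ⊛ h) n ∎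

  -- Peeling off the constant term of the left factor turns this into an induction on the
  -- coefficient index, with no reindexing of a double sum.
  ⊛-assoc : ∀ f g h n → ((f ⊛ g) ⊛ h) n ≈ (f ⊛ (g ⊛ h)) n
  ⊛-assoc f g h zero =
    solve 3 (λ x y z → con (+ 0) :+ (con (+ 0) :+ x :* y) :* z := con (+ 0) :+ x :* (con (+ 0) :+ y :* z))
      refl (f 0) (g 0) (h 0)
  ⊛-assoc f g h (suc n) = begin
    ((f ⊛ g) ⊛ h) (suc n)
      ≈⟨ ⊛-suc (f ⊛ g) h n ⟩
    (f ⊛ g) 0 * h (suc n) + (((f ⊛ g) ∘ suc) ⊛ h) n
      ≈⟨ +-cong (*-congʳ (+-identityˡ _)) (⊛-congʳ h n (⊛-suc f g)) ⟩
    f 0 * g 0 * h (suc n) + ((λ i → f 0 * g (suc i) + ((f ∘ suc) ⊛ g) i) ⊛ h) n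
      ≈⟨ +-congˡ (⊛-linˡ (f 0) (g ∘ suc) _ h n) ⟩
    f 0 * g 0 * h (suc n) + (f 0 * ((g ∘ suc) ⊛ h) n + (((f ∘ suc) ⊛ g) ⊛ h) n)
      ≈⟨ solve 5 (λ a b c d e → a :* b :* c :+ (a :* d :+ e) := a :* (b :* c :+ d) :+ e) refl _ _ _ _ _ ⟩
    f 0 * (g 0 * h (suc n) + ((g ∘ suc) ⊛ h) n) + (((f ∘ suc) ⊛ g) ⊛ h) n
      ≈⟨ +-cong (*-congˡ (sym (⊛-suc g h n))) (⊛-assoc (f ∘ suc) g h n) ⟩
    f 0 * (g ⊛ h) (suc n) + ((f ∘ suc) ⊛ (g ⊛ h)) n
      ≈⟨ ⊛-suc f (g ⊛ h) n ⟨
    (f ⊛ (g ⊛ h)) (suc n) ∎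

  ⊛-identityʳ : ∀ f n → (f ⊛ one) n ≈ f n
  ⊛-identityʳ f zero    = trans (+-identityˡ _) (*-identityʳ (f 0))
  ⊛-identityʳ f (suc n) =
    trans (⊛-suc f one n)
          (trans (+-cong (zeroʳ (f 0)) (⊛-identityʳ (f ∘ suc) n)) (+-identityˡ _))

  x·_ : Series → Series
  (x· f) zero    = 0#
  (x· f) (suc n) = f n

  ⊛-x·-zero : ∀ f g → (f ⊛ (x· g)) 0 ≈ 0#
  ⊛-x·-zero f g = trans (+-identityˡ _) (zeroʳ (f 0))

  ⊛-x· : ∀ f g n → (f ⊛ (x· g)) (suc n) ≈ (f ⊛ g) n
  ⊛-x· f g zero    = trans (⊛-suc f (x· g) 0)
    (trans (+-congˡ (⊛-x·-zero (f ∘ suc) g)) (+-comm _ 0#))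
  ⊛-x· f g (suc n) = trans (⊛-suc f (x· g) (suc n))
    (trans (+-congˡ (⊛-x· (f ∘ suc) g n)) (sym (⊛-suc f g n)))

  ⊛-scaleʳ : ∀ a f g n → (f ⊛ (λ i → a * g i)) n ≈ a * (f ⊛ g) n
  ⊛-scaleʳ a f g n = trans
    (sumTo-cong (suc n) (λ i → solve 3 (λ a x y → x :* (a :* y) := a :* (x :* y)) refl a (f i) (g (n ∸ i))))
    (sumTo-*ˡ (suc n) a _)

  module _ (h : Series) (h0 : h 0 ≈ 0#) where

    ⊛-tail : ∀ f n → (h ⊛ f) (suc n) ≈ ((h ∘ suc) ⊛ f) n
    ⊛-tail f n = trans (⊛-suc h f n) (trans (+-congʳ (trans (*-congʳ h0) (zeroˡ _))) (+-identityˡ _))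

    pow-order : ∀ k i → i < k → pow h k i ≈ 0#
    pow-order (suc k) zero    _ = trans (+-identityˡ _) (trans (*-congʳ h0) (zeroˡ _))
    pow-order (suc k) (suc i) (s≤s i<k) = trans (⊛-tail (pow h k) i)
      (⊛-zeroʳ (h ∘ suc) i (λ j j≤i → pow-order k j (ℕₚ.≤-<-trans j≤i i<k)))

    -- `geom` cuts the sum of powers at a point that depends on the coefficient. Later powers do not
    -- reach that coefficient, so one common cut serves a whole convolution.
    geom-stable : ∀ m i → i < m → sumTo m (λ k → pow h k i) ≈ geom h i
    geom-stable (suc m) i i<1+m with ℕₚ.m≤n⇒m<n∨m≡n (ℕ.s≤s⁻¹ i<1+m)
    ... | inj₁ i<m = trans (+-cong (geom-stable m i i<m) (pow-order m i i<m)) (+-identityʳ _)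
    ... | inj₂ ≡.refl = refl

    -- The equation G = 1 + hG, read at x^(n+1).
    geom-suc : ∀ n → geom h (suc n) ≈ ((h ∘ suc) ⊛ geom h) n
    geom-suc n = begin
      sumTo (suc (suc n)) (λ k → pow h k (suc n))
        ≈⟨ sumTo-head (suc n) _ ⟩
      0# + sumTo (suc n) (λ k → (h ⊛ pow h k) (suc n))
        ≈⟨ +-identityˡ _ ⟩
      sumTo (suc n) (λ k → (h ⊛ pow h k) (suc n))
        ≈⟨ sumTo-cong (suc n) (λ k → ⊛-tail (pow h k) n) ⟩
      sumTo (suc n) (λ k → ((h ∘ suc) ⊛ pow h k) n)
        ≈⟨ ⊛-sumʳ (suc n) (h ∘ suc) (pow h) n ⟩
      ((h ∘ suc) ⊛ (λ i → sumTo (suc n) (λ k → pow h k i))) n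
        ≈⟨ ⊛-congˡ≤ (h ∘ suc) n (λ i i≤n → geom-stable (suc n) i (s≤s i≤n)) ⟩
      ((h ∘ suc) ⊛ geom h) n ∎

suc-∸-suc : ∀ {j D} → j < D → D ∸ j ≡ suc (D ∸ suc j)
suc-∸-suc (s≤s j≤D) = ℕₚ.+-∸-assoc 1 j≤D

-- The continued fraction and weighted Motzkin paths.

module ContinuedFraction {c ℓ : Level} (R : CommutativeRing c ℓ)
                         (p q y : CommutativeRing.Carrier R) where
  open CommutativeRing R
  open Series R
  open FiniteSums R
  open Convolution R
  open IntegerCoefficients R
  open import Relation.Binary.Reasoning.Setoid setoid

  private
    b lam : ℕ → Carrier
    b  = bcf p q y
    lam = lcf p q y

  -- With D levels kept, level D j is the generating function of Motzkin paths from height 0 to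
  -- height j (or, reversed, from j to 0): it factors over the last passages below each height.
  below level : ℕ → ℕ → Series
  below D zero    = one
  below D (suc j) = x· (λ n → lam (suc j) * level D j n)
  level D j = cfTrunc p q y j (D ∸ j) ⊛ below D j

  cfTrunc-0 : ∀ j d → cfTrunc p q y j d 0 ≈ 1#
  cfTrunc-0 j zero    = refl
  cfTrunc-0 j (suc d) = +-identityˡ 1#

  level-0 : ∀ D j → level D j 0 ≈ one j
  level-0 D j = trans (+-identityˡ _)
    (trans (*-congʳ (cfTrunc-0 j (D ∸ j))) (trans (*-identityˡ _) (below-0 j)))
    where
    below-0 : ∀ j → below D j 0 ≈ one j
    below-0 zero    = refl
    below-0 (suc j) = refl

  -- At height 0 `pred` points back to height 0, but the term is killed by λ_0 = y [0]² = 0. This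
  -- lets the recurrence hold uniformly in `j`.
  below-suc : ∀ D j n → below D j (suc n) ≈ lam j * level D (pred j) n
  below-suc D zero    n = sym (trans (*-congʳ (trans (*-congˡ (zeroˡ 0#)) (zeroʳ y))) (zeroˡ _))
  below-suc D (suc j) n = refl

  level-up : ∀ D j n → level D (suc j) (suc n) ≈
    lam (suc j) * (cfTrunc p q y (suc j) (D ∸ suc j) ⊛ level D j) n
  level-up D j n = trans (⊛-x· _ _ n) (⊛-scaleʳ (lam (suc j)) _ (level D j) n)

  -- Multiplying T_j = 1 + (b_j x + λ_{j+1} x² T_{j+1}) T_j by the factors below height j.
  level-suc : ∀ D j n → j < D →
    level D j (suc n) ≈ level D (suc j) n + b j * level D j n + lam j * level D (pred j) n
  level-suc D j n j<D = begin
    (cfTrunc p q y j (D ∸ j) ⊛ below D j) (suc n)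
      -- As j < D, at least one level of the truncation is left, so it unfolds to a `geom`.
      ≡⟨ ≡.cong (λ d → (cfTrunc p q y j d ⊛ below D j) (suc n)) D∸j ⟩
    (T ⊛ below D j) (suc n)
      ≈⟨ ⊛-suc T (below D j) n ⟩
    T 0 * below D j (suc n) + ((T ∘ suc) ⊛ below D j) n
      ≈⟨ +-cong (trans (*-congʳ (+-identityˡ 1#)) (*-identityˡ _)) (⊛-congʳ (below D j) n (geom-suc h refl)) ⟩
    below D j (suc n) + (((h ∘ suc) ⊛ T) ⊛ below D j) n
      ≈⟨ +-congˡ (⊛-assoc (h ∘ suc) T (below D j) n) ⟩
    below D j (suc n) + ((h ∘ suc) ⊛ (T ⊛ below D j)) n
      ≡⟨ ≡.cong (λ d → below D j (suc n) + ((h ∘ suc) ⊛ (cfTrunc p q y j d ⊛ below D j)) n) (≡.sym D∸j) ⟩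
    below D j (suc n) + ((h ∘ suc) ⊛ level D j) n
      ≈⟨ +-cong (below-suc D j n) (first-step n) ⟩
    lam j * level D (pred j) n + (b j * level D j n + level D (suc j) n)
      ≈⟨ solve 3 (λ u v w → u :+ (v :+ w) := w :+ v :+ u) refl _ _ _ ⟩
    level D (suc j) n + b j * level D j n + lam j * level D (pred j) n ∎
    where
    T′ h T : Series
    T′ = cfTrunc p q y (suc j) (D ∸ suc j)
    h = denomTail p q y j T′
    T = cfTrunc p q y j (suc (D ∸ suc j))

    D∸j : D ∸ j ≡ suc (D ∸ suc j)
    D∸j = suc-∸-suc j<D

    first-step : ∀ n → ((h ∘ suc) ⊛ level D j) n ≈ b j * level D j n + level D (suc j) n
    first-step zero    = trans (+-identityˡ _) (sym (trans (+-congˡ (⊛-x·-zero T′ (λ n → lam (suc j) * level D j n))) (+-identityʳ _)))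
    first-step (suc n) = trans (⊛-suc _ (level D j) n) (+-congˡ (begin
      ((λ i → lam (suc j) * T′ i) ⊛ level D j) n
        ≈⟨ sumTo-cong (suc n) (λ i → *-assoc (lam (suc j)) (T′ i) _) ⟩
      sumTo (suc n) (λ i → lam (suc j) * (T′ i * level D j (n ∸ i)))
        ≈⟨ sumTo-*ˡ (suc n) (lam (suc j)) _ ⟩
      lam (suc j) * (T′ ⊛ level D j) n
        ≈⟨ level-up D j n ⟨
      level D (suc j) (suc n) ∎))

  module _ (a : ℕ → ℕ → Carrier) (a-zero : ∀ j → a 0 j ≈ one j)
           (a-suc : ∀ n j → a (suc n) j ≈ a n (suc j) + b j * a n j + lam j * a n (pred j)) where

    -- A path of n steps from height j climbs no higher than n + j, so below depth D the truncation
    -- is invisible and the recurrence determines everything.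
    level-unique : ∀ D n j → n ℕ.+ j < D → a n j ≈ level D j n
    level-unique D zero    j j<D = trans (a-zero j) (sym (level-0 D j))
    level-unique D (suc n) j n+j<D = begin
      a (suc n) j
        ≈⟨ a-suc n j ⟩
      a n (suc j) + b j * a n j + lam j * a n (pred j)
        ≈⟨ +-cong (+-cong (level-unique D n (suc j) (≡.subst (_< D) (≡.sym (ℕₚ.+-suc n j)) n+j<D))
                          (*-congˡ (level-unique D n j n+j<D′)))
                  (*-congˡ (level-unique D n (pred j)
                    (ℕₚ.≤-<-trans (ℕₚ.+-monoʳ-≤ n ℕₚ.pred[n]≤n) n+j<D′))) ⟩
      level D (suc j) n + b j * level D j n + lam j * level D (pred j) n
        ≈⟨ level-suc D j n (ℕₚ.≤-<-trans (ℕₚ.m≤n+m j (suc n)) n+j<D) ⟨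
      level D j (suc n) ∎
      where
      n+j<D′ : n ℕ.+ j < D
      n+j<D′ = ℕₚ.<-trans (ℕₚ.n<1+n _) n+j<D

    Fcf-unique : ∀ n → a n 0 ≈ Fcf q p y n
    -- Depth n + 1 is just enough for n steps from height 0; there `below` is `one`, so the level is
    -- the truncated fraction itself.
    Fcf-unique n = trans (level-unique (suc n) n 0 (s≤s (ℕₚ.≤-reflexive (ℕₚ.+-identityʳ n))))
                         (⊛-identityʳ _ n)

-- Integer powers of q.

module Powers {c ℓ : Level} (R : CommutativeRing c ℓ) (q qi : CommutativeRing.Carrier R)
              (q*qi≈1 : CommutativeRing._≈_ R (CommutativeRing._*_ R q qi) (CommutativeRing.1# R)) where
  open CommutativeRing R hiding (zero)
  open Series R
  open IntegerCoefficients R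
  open import Relation.Binary.Reasoning.Setoid setoid

  1^^ : ∀ n → 1# ^^ n ≈ 1#
  1^^ zero    = refl
  1^^ (suc n) = trans (*-identityˡ _) (1^^ n)

  ^^-+ : ∀ a m n → a ^^ (m ℕ.+ n) ≈ a ^^ m * a ^^ n
  ^^-+ a zero    n = sym (*-identityˡ _)
  ^^-+ a (suc m) n = trans (*-congˡ (^^-+ a m n)) (sym (*-assoc a _ _))

  ^^-* : ∀ a m n → (a ^^ m) ^^ n ≈ a ^^ (m ℕ.* n)
  ^^-* a m zero    = reflexive (≡.cong (a ^^_) (≡.sym (ℕₚ.*-zeroʳ m)))
  ^^-* a m (suc n) = begin
    a ^^ m * (a ^^ m) ^^ n     ≈⟨ *-congˡ (^^-* a m n) ⟩
    a ^^ m * a ^^ (m ℕ.* n)    ≈⟨ ^^-+ a m (m ℕ.* n) ⟨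
    a ^^ (m ℕ.+ m ℕ.* n)       ≡⟨ ≡.cong (a ^^_) (≡.sym (ℕₚ.*-suc m n)) ⟩
    a ^^ (m ℕ.* suc n)         ∎

  q^^*qi^^ : ∀ m → q ^^ m * qi ^^ m ≈ 1#
  q^^*qi^^ zero    = *-identityˡ 1#
  q^^*qi^^ (suc m) = begin
    q * q ^^ m * (qi * qi ^^ m)    ≈⟨ solve 4 (λ a b c d → a :* b :* (c :* d) := a :* c :* (b :* d)) refl q (q ^^ m) qi (qi ^^ m) ⟩
    q * qi * (q ^^ m * qi ^^ m)    ≈⟨ *-cong q*qi≈1 (q^^*qi^^ m) ⟩
    1# * 1#                        ≈⟨ *-identityˡ 1# ⟩
    1#                             ∎

  q^ : ℤ → Carrier
  q^ = zpow q qi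

  q^-neg : ∀ n → qi ^^ n ≈ q^ (ℤ.- (+ n))
  q^-neg zero    = refl
  q^-neg (suc n) = refl

  q^-⊖ : ∀ m n → q^ (m ⊖ n) ≈ q ^^ m * qi ^^ n
  q^-⊖ m zero          = sym (*-identityʳ _)
  q^-⊖ zero (suc n)    = sym (*-identityˡ _)
  q^-⊖ (suc m) (suc n) = begin
    q^ (suc m ⊖ suc n)             ≡⟨ ≡.cong q^ (ℤₚ.[1+m]⊖[1+n]≡m⊖n m n) ⟩
    q^ (m ⊖ n)                     ≈⟨ q^-⊖ m n ⟩
    q ^^ m * qi ^^ n               ≈⟨ *-identityˡ _ ⟨
    1# * (q ^^ m * qi ^^ n)        ≈⟨ *-congʳ q*qi≈1 ⟨
    q * qi * (q ^^ m * qi ^^ n)    ≈⟨ solve 4 (λ a b c d → a :* c :* (b :* d) := a :* b :* (c :* d)) refl q (q ^^ m) qi (qi ^^ n) ⟩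
    q * q ^^ m * (qi * qi ^^ n)    ∎

  q^-+ : ∀ i j → q^ (i ℤ.+ j) ≈ q^ i * q^ j
  q^-+ (+ m) (+ n)       = ^^-+ q m n
  q^-+ (+ m) -[1+ n ]    = q^-⊖ m (suc n)
  q^-+ -[1+ m ] (+ n)    = trans (q^-⊖ n (suc m)) (*-comm _ _)
  q^-+ -[1+ m ] -[1+ n ] = trans
    (reflexive (≡.cong (λ k → qi ^^ suc k) (≡.sym (ℕₚ.+-suc m n)))) (^^-+ qi (suc m) (suc n))

  qi^^^^ : ∀ m i → (qi ^^ m) ^^ i ≈ q^ (ℤ.- (+ m ℤ.* + i))
  qi^^^^ m i = trans (^^-* qi m i) (trans (q^-neg (m ℕ.* i))
    (reflexive (≡.cong (λ k → q^ (ℤ.- k)) (ℤₚ.pos-* m i))))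

  q^^^^ : ∀ m i → (q ^^ m) ^^ i ≈ q^ (+ m ℤ.* + i)
  q^^^^ m i = trans (^^-* q m i) (reflexive (≡.cong q^ (ℤₚ.pos-* m i)))

-- q-integers, falling products and the product of the factors q^l - z.

module QAnalogues {c ℓ : Level} (R : CommutativeRing c ℓ) (q qi : CommutativeRing.Carrier R)
                  (q*qi≈1 : CommutativeRing._≈_ R (CommutativeRing._*_ R q qi) (CommutativeRing.1# R)) where
  open CommutativeRing R hiding (zero)
  open Series R
  open FiniteSums R
  open Convolution R using (x·_)
  open IntegerCoefficients R
  open Powers R q qi q*qi≈1 public
  open import Relation.Binary.Reasoning.Setoid setoid

  [_] : ℕ → Carrier
  [ n ] = qint q n

  qint-suc : ∀ n → [ suc n ] ≈ [ n ] + q ^^ n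
  qint-suc n = trans (geometric (suc n)) (+-congʳ (sym (geometric n)))
    where
    geometric : ∀ n → [ n ] ≈ sumTo n (q ^^_)
    geometric n = sumTo-cong n (λ i → trans (*-congʳ (1^^ (n ∸ suc i))) (*-identityˡ _))

  qint-+ : ∀ m n → [ m ℕ.+ n ] ≈ [ m ] + q ^^ m * [ n ]
  qint-+ m zero = trans (reflexive (≡.cong [_] (ℕₚ.+-identityʳ m)))
    (sym (trans (+-congˡ (zeroʳ _)) (+-identityʳ _)))
  qint-+ m (suc n) = begin
    [ m ℕ.+ suc n ]
      ≡⟨ ≡.cong [_] (ℕₚ.+-suc m n) ⟩
    [ suc (m ℕ.+ n) ]
      ≈⟨ qint-suc (m ℕ.+ n) ⟩
    [ m ℕ.+ n ] + q ^^ (m ℕ.+ n)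
      ≈⟨ +-cong (qint-+ m n) (^^-+ q m n) ⟩
    [ m ] + q ^^ m * [ n ] + q ^^ m * q ^^ n
      ≈⟨ solve 4 (λ a b c d → a :+ b :* c :+ b :* d := a :+ b :* (c :+ d)) refl [ m ] (q ^^ m) [ n ] (q ^^ n) ⟩
    [ m ] + q ^^ m * ([ n ] + q ^^ n)
      ≈⟨ +-congˡ (*-congˡ (qint-suc n)) ⟨
    [ m ] + q ^^ m * [ suc n ] ∎

  qint-1 : [ 1 ] ≈ 1#
  qint-1 = trans (qint-suc 0) (+-identityˡ 1#)

  qint-suc′ : ∀ n → [ suc n ] ≈ 1# + q * [ n ]
  qint-suc′ n = trans (qint-+ 1 n) (+-cong qint-1 (*-congʳ (*-identityʳ q)))

  -- The product [n][n-1]⋯[n-j+1], set to 0 for j > n, where a factor [0] would occur.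
  fall : ℕ → ℕ → Carrier
  fall n       zero    = 1#
  fall zero    (suc j) = 0#
  fall (suc n) (suc j) = [ suc n ] * fall n j

  fall-vanish : ∀ n j → n < j → fall n j ≈ 0#
  fall-vanish zero    (suc j) _         = refl
  fall-vanish (suc n) (suc j) (s≤s n<j) = trans (*-congˡ (fall-vanish n j n<j)) (zeroʳ _)

  -- The definition splits off the top factor; this splits off the bottom one, since q^j [n-j] = [n]
  -- - [j]. Keeping the power of q on the left avoids n - j, and for n < j both sides vanish. The
  -- companion is the same fact times q, by [n+1] - [j+1] = q([n] - [j]), and it feeds the
  -- induction.
  fall-last     : ∀ n j → fall n (suc j) * q ^^ j ≈ fall n j * ([ n ] - [ j ])
  fall-last-suc : ∀ n j → fall n (suc j) * q ^^ suc j ≈ fall n j * ([ suc n ] - [ suc j ])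
  fall-last zero    zero    = solve 0 (con (+ 0) :* con (+ 1) := con (+ 1) :* (con (+ 0) :- con (+ 0))) refl
  fall-last zero    (suc j) = trans (zeroˡ _) (sym (zeroˡ _))
  fall-last (suc n) zero    =
    solve 1 (λ a → a :* con (+ 1) :* con (+ 1) := con (+ 1) :* (a :- con (+ 0))) refl [ suc n ]
  fall-last (suc n) (suc j) = begin
    [ suc n ] * fall n (suc j) * (q * q ^^ j)           ≈⟨ *-assoc _ _ _ ⟩
    [ suc n ] * (fall n (suc j) * (q * q ^^ j))         ≈⟨ *-congˡ (fall-last-suc n j) ⟩
    [ suc n ] * (fall n j * ([ suc n ] - [ suc j ]))    ≈⟨ *-assoc _ _ _ ⟨
    [ suc n ] * fall n j * ([ suc n ] - [ suc j ])      ∎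

  fall-last-suc n j = begin
    fall n (suc j) * (q * q ^^ j)
      ≈⟨ solve 3 (λ b c d → b :* (c :* d) := c :* (b :* d)) refl (fall n (suc j)) q (q ^^ j) ⟩
    q * (fall n (suc j) * q ^^ j)
      ≈⟨ *-congˡ (fall-last n j) ⟩
    q * (fall n j * ([ n ] - [ j ]))
      ≈⟨ solve 4 (λ c f m k → c :* (f :* (m :- k)) := f :* ((con (+ 1) :+ c :* m) :- (con (+ 1) :+ c :* k)))
           refl q (fall n j) [ n ] [ j ] ⟩
    fall n j * ((1# + q * [ n ]) - (1# + q * [ j ]))
      ≈⟨ *-congˡ (+-cong (qint-suc′ n) (-‿cong (qint-suc′ j))) ⟨
    fall n j * ([ suc n ] - [ suc j ]) ∎

  -- coef j i is the coefficient of z^i in qprod j z.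
  coef : ℕ → ℕ → Carrier
  coef zero    zero    = 1#
  coef zero    (suc i) = 0#
  coef (suc j) zero    = q ^^ j * coef j zero
  coef (suc j) (suc i) = q ^^ j * coef j (suc i) - coef j i

  qprod : ℕ → Carrier → Carrier
  qprod zero    z = 1#
  qprod (suc j) z = qprod j z * (q ^^ j - z)

  -- The degree in z is j, so every cut N > j gives the full polynomial; this slack is needed
  -- because the multiplication by q^j - z meets sums of two different lengths.
  coef-sum : ∀ j N z → j < N → sumTo N (λ i → coef j i * z ^^ i) ≈ qprod j z
  coef-sum zero (suc N) z _ = begin
    sumTo (suc N) (λ i → coef 0 i * z ^^ i)
      ≈⟨ sumTo-head N _ ⟩
    1# * 1# + sumTo N (λ i → 0# * z ^^ suc i)
      ≈⟨ +-cong (*-identityˡ 1#) (sumTo-zero< N (λ i _ → zeroˡ _)) ⟩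
    1# + 0#
      ≈⟨ +-identityʳ 1# ⟩
    1# ∎
  coef-sum (suc j) (suc N) z (s≤s j<N) = begin
    sumTo (suc N) (λ i → coef (suc j) i * z ^^ i)
      ≈⟨ sumTo-head N _ ⟩
    q ^^ j * coef j 0 * 1# + sumTo N (λ i → (q ^^ j * coef j (suc i) - coef j i) * (z * z ^^ i))
      ≈⟨ +-congˡ (sumTo-cong N (λ i →
           solve 5 (λ a b c d e → (a :* b :- c) :* (d :* e) := a :* (b :* (d :* e)) :+ (:- d) :* (c :* e))
             refl (q ^^ j) (coef j (suc i)) (coef j i) z (z ^^ i))) ⟩
    q ^^ j * coef j 0 * 1#
      + sumTo N (λ i → q ^^ j * (coef j (suc i) * z ^^ suc i) + - z * (coef j i * z ^^ i))
      ≈⟨ +-congˡ (trans (sumTo-+ N _ _) (+-cong (sumTo-*ˡ N _ _) (sumTo-*ˡ N _ _))) ⟩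
    q ^^ j * coef j 0 * 1#
      + (q ^^ j * sumTo N (λ i → coef j (suc i) * z ^^ suc i) + - z * sumTo N (λ i → coef j i * z ^^ i))
      ≈⟨ solve 5 (λ a b c d e → a :* b :* con (+ 1) :+ (a :* c :+ (:- d) :* e)
                             := a :* (b :* con (+ 1) :+ c) :+ (:- d) :* e) refl _ _ _ _ _ ⟩
    q ^^ j * (coef j 0 * 1# + sumTo N (λ i → coef j (suc i) * z ^^ suc i))
      + - z * sumTo N (λ i → coef j i * z ^^ i)
      ≈⟨ +-cong (*-congˡ (trans (sym (sumTo-head N _)) (coef-sum j (suc N) z (ℕₚ.m<n⇒m<1+n j<N))))
                (*-congˡ (coef-sum j N z j<N)) ⟩
    q ^^ j * qprod j z + - z * qprod j z
      ≈⟨ solve 3 (λ a z h → a :* h :+ (:- z) :* h := h :* (a :- z)) refl (q ^^ j) z (qprod j z) ⟩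
    qprod j z * (q ^^ j - z) ∎

  qfactor : ℕ → Carrier
  qfactor zero    = 1#
  qfactor (suc j) = qfactor j * ((1# - q) * q ^^ j)

  [1-q]qint : ∀ n → (1# - q) * [ n ] ≈ 1# - q ^^ n
  [1-q]qint zero    = trans (zeroʳ _) (sym (-‿inverseʳ 1#))
  [1-q]qint (suc n) = begin
    (1# - q) * [ suc n ]                   ≈⟨ *-congˡ (qint-suc n) ⟩
    (1# - q) * ([ n ] + q ^^ n)            ≈⟨ distribˡ _ _ _ ⟩
    (1# - q) * [ n ] + (1# - q) * q ^^ n   ≈⟨ +-congʳ ([1-q]qint n) ⟩
    1# - q ^^ n + (1# - q) * q ^^ n        ≈⟨ solve 2 (λ a b → con (+ 1) :- b :+ (con (+ 1) :- a) :* b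
                                                             := con (+ 1) :- a :* b) refl q (q ^^ n) ⟩
    1# - q * q ^^ n                        ∎

  -- Each factor is q^l - q^t = (1-q) q^l [t-l]; the part free of t is collected in `qfactor`. For t
  -- < j both sides contain a zero factor.
  qprod-fall : ∀ j t → qprod j (q ^^ t) ≈ qfactor j * fall t j
  qprod-fall zero    t = sym (*-identityˡ 1#)
  qprod-fall (suc j) t = begin
    qprod j (q ^^ t) * (q ^^ j - q ^^ t)
      ≈⟨ *-cong (qprod-fall j t)
           (solve 2 (λ a b → a :- b := (con (+ 1) :- b) :- (con (+ 1) :- a)) refl (q ^^ j) (q ^^ t)) ⟩
    qfactor j * fall t j * ((1# - q ^^ t) - (1# - q ^^ j))
      ≈⟨ *-congˡ (+-cong ([1-q]qint t) (-‿cong ([1-q]qint j))) ⟨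
    qfactor j * fall t j * ((1# - q) * [ t ] - (1# - q) * [ j ])
      ≈⟨ solve 5 (λ r f p a b → r :* f :* (p :* a :- p :* b) := r :* p :* (f :* (a :- b)))
           refl (qfactor j) (fall t j) (1# - q) [ t ] [ j ] ⟩
    qfactor j * (1# - q) * (fall t j * ([ t ] - [ j ]))
      ≈⟨ *-congˡ (fall-last t j) ⟨
    qfactor j * (1# - q) * (fall t (suc j) * q ^^ j)
      ≈⟨ solve 4 (λ r p f a → r :* p :* (f :* a) := r :* (p :* a) :* f)
           refl (qfactor j) (1# - q) (fall t (suc j)) (q ^^ j) ⟩
    qfactor j * ((1# - q) * q ^^ j) * fall t (suc j) ∎

  -- The q-derivative of Π_{l ≤ j} (q^l − z) is −[j+1] Π_{l < j} (q^l − z).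
  coef-derivative : ∀ j i → [ suc i ] * coef (suc j) (suc i) ≈ - ([ suc j ] * coef j i)
  coef-derivative zero zero =
    solve 1 (λ a → a :* (con (+ 1) :* con (+ 0) :- con (+ 1)) := :- (a :* con (+ 1))) refl [ 1 ]
  coef-derivative zero (suc i) =
    solve 2 (λ a b → a :* (con (+ 1) :* con (+ 0) :- con (+ 0)) := :- (b :* con (+ 0))) refl [ suc (suc i) ] [ 1 ]
  coef-derivative (suc j) zero = by-relation
    (+-cong (*-congˡ (sym (coef-derivative j 0)))
            (+-cong (*-congˡ qint-1) (*-congˡ (sym (qint-suc′ (suc j))))))
    (solve 7 (λ S₁ q qj c₀ c₁ J₁ J₂ →
        S₁ :* (q :* qj :* c₁ :- qj :* c₀)
          :+ (q :* qj :* (:- (J₁ :* c₀)) :+ (qj :* c₀ :* S₁ :+ qj :* c₀ :* (con (+ 1) :+ q :* J₁)))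
     := :- (J₂ :* (qj :* c₀))
          :+ (q :* qj :* (S₁ :* c₁) :+ (qj :* c₀ :* con (+ 1) :+ qj :* c₀ :* J₂)))
      refl [ 1 ] q (q ^^ j) (coef j 0) (coef (suc j) 1) [ suc j ] [ suc (suc j) ])
  coef-derivative (suc j) (suc i) = by-relation
    -- This is the q-Leibniz rule for the new factor q^(j+1) - z: its constant part uses the
    -- hypothesis at i + 1, its z part the hypothesis at i, where [i+2] = 1 + q[i+1] provides the
    -- extra term.
    (+-cong (*-congˡ (sym (coef-derivative j (suc i))))
            (+-cong (*-congʳ (qint-suc′ (suc i)))
                    (+-cong (*-congˡ (coef-derivative j i)) (*-congʳ (sym (qint-suc′ (suc j)))))))
    (solve 9 (λ S₁ S₂ q qj c₀ c₁ c₂ J₁ J₂ →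
        S₂ :* (q :* qj :* c₂ :- (qj :* c₁ :- c₀))
          :+ (q :* qj :* (:- (J₁ :* c₁))
              :+ (S₂ :* (qj :* c₁ :- c₀)
              :+ (q :* (S₁ :* (qj :* c₁ :- c₀)) :+ (con (+ 1) :+ q :* J₁) :* (qj :* c₁ :- c₀))))
     := :- (J₂ :* (qj :* c₁ :- c₀))
          :+ (q :* qj :* (S₂ :* c₂)
              :+ ((con (+ 1) :+ q :* S₁) :* (qj :* c₁ :- c₀)
              :+ (q :* (:- (J₁ :* c₀)) :+ J₂ :* (qj :* c₁ :- c₀)))))
      refl [ suc i ] [ suc (suc i) ] q (q ^^ j) (coef j i) (coef j (suc i)) (coef (suc j) (suc (suc i)))
      [ suc j ] [ suc (suc j) ])

-- Exponents of q along a diagonal of constant i + m.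

module Exponents where
  open import Data.Integer using (_+_; _*_; _-_; -_)
  open IntegerCoefficients ℤₚ.+-*-commutativeRing

  -- With i + m fixed, an exponent quadratic in m becomes linear in i, as an evaluation of a
  -- polynomial at a power of q requires. The two sides differ by m + K times the defect of the
  -- hypothesis, which explains the multiplier.
  exponent-w : ∀ i m K → i + m ≡ + 1 + K →
    m - m * m + - (m * i) ≡ - ((+ 1 + K) * K) + K * i
  exponent-w i m K h = by-relation (≡.cong ((m + K) *_) h)
    (solve 3 (λ i m K → m :- m :* m :+ :- (m :* i) :+ (m :+ K) :* (i :+ m)
      := :- ((con (+ 1) :+ K) :* K) :+ K :* i :+ (m :+ K) :* (con (+ 1) :+ K)) ≡.refl i m K)

  exponent-v : ∀ i m K → i + m ≡ K →
    - m - m * m + - (m * i) ≡ - ((+ 1 + K) * K) + (+ 1 + K) * i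
  exponent-v i m K h = by-relation (≡.cong ((m + + 1 + K) *_) h)
    (solve 3 (λ i m K → :- m :- m :* m :+ :- (m :* i) :+ (m :+ con (+ 1) :+ K) :* (i :+ m)
      := :- ((con (+ 1) :+ K) :* K) :+ (con (+ 1) :+ K) :* i :+ (m :+ con (+ 1) :+ K) :* K) ≡.refl i m K)

  exponent-Ê : ∀ i m k → i + m ≡ k →
    m - m * m + - (m * i) ≡ (k - k * k) + ((k * i - k) + m)
  exponent-Ê i m k h = by-relation (≡.cong ((m + k) *_) h)
    (solve 3 (λ i m k → m :- m :* m :+ :- (m :* i) :+ (m :+ k) :* (i :+ m)
      := (k :- k :* k) :+ ((k :* i :- k) :+ m) :+ (m :+ k) :* k) ≡.refl i m k)

  exponent-Ê′ : ∀ i m k → (+ 1 + i) + m ≡ k →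
    - m - m * m + - (m * i) ≡ (k - k * k) + (k * (+ 1 + i) - k)
  exponent-Ê′ i m k h = by-relation (≡.cong ((m + k) *_) h)
    (solve 3 (λ i m k → :- m :- m :* m :+ :- (m :* i) :+ (m :+ k) :* ((con (+ 1) :+ i) :+ m)
      := (k :- k :* k) :+ (k :* (con (+ 1) :+ i) :- k) :+ (m :+ k) :* k) ≡.refl i m k)

-- The orthogonal polynomials on the support.

module Moments {c ℓ : Level} (R : CommutativeRing c ℓ) (q qi y : CommutativeRing.Carrier R)
               (q*qi≈1 : CommutativeRing._≈_ R (CommutativeRing._*_ R q qi) (CommutativeRing.1# R)) where
  open CommutativeRing R hiding (zero)
  open Series R
  open FiniteSums R
  open Convolution R using (x·_)
  open IntegerCoefficients R
  open QAnalogues R q qi q*qi≈1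
  open Exponents
  open import Relation.Binary.Reasoning.Setoid setoid

  -- f m i is the coefficient of y^i in the value of f at x_m.
  Grid : Set c
  Grid = ℕ → ℕ → Carrier

  -- Multiplication by y.
  shift : Grid → Grid
  shift f m zero    = 0#
  shift f m (suc i) = f m i

  mulX : Grid → Grid
  mulX f m i = [ m ] * (f m i - qi ^^ m * shift f m i)

  orth : ℕ → Grid
  orth j m i = coef j i * ((qi ^^ m) ^^ i * fall (i ℕ.+ m) j)

  private
    qint-suc[i+m] : ∀ i m → [ suc (i ℕ.+ m) ] ≈ [ m ] + q ^^ m * [ suc i ]
    qint-suc[i+m] i m = trans (reflexive (≡.cong [_] (ℕₚ.+-comm (suc i) m))) (qint-+ m (suc i))

  three-term : ∀ j m i → mulX (orth j) m i ≈
    orth (suc j) m i + [ j ] * orth j m i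
      + [ suc j ] * shift (orth j) m i + [ j ] * ([ j ] * shift (orth (pred j)) m i)
  three-term j m zero = by-relation (*-congˡ (fall-last m j))
    (solve 8 (λ M c f f′ qj J J₁ u →
        M :* (c :* (con (+ 1) :* f) :- u :* con (+ 0)) :+ c :* (f′ :* qj)
     := (qj :* c :* (con (+ 1) :* f′) :+ J :* (c :* (con (+ 1) :* f))
          :+ J₁ :* con (+ 0) :+ J :* (J :* con (+ 0))) :+ c :* (f :* (M :- J)))
      refl [ m ] (coef j 0) (fall m j) (fall m (suc j)) (q ^^ j) [ j ] [ suc j ] (qi ^^ m))
  three-term zero m (suc i) = by-relation
    (+-cong (*-congˡ (qint-suc[i+m] i m))
      (+-cong (*-congˡ (q^^*qi^^ m)) (*-congˡ (coef-derivative 0 i))))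
    (solve 8 (λ M N S J₁ C₀ u U qm →
        M :* (con (+ 0) :* (u :* U :* con (+ 1)) :- u :* (C₀ :* (U :* con (+ 1))))
          :+ (:- (C₀ :* u :* U) :* N
          :+ (:- (C₀ :* U :* S) :* (qm :* u)
          :+ U :* (S :* (con (+ 1) :* con (+ 0) :- C₀))))
     := ((con (+ 1) :* con (+ 0) :- C₀) :* (u :* U :* (N :* con (+ 1)))
          :+ con (+ 0) :* (con (+ 0) :* (u :* U :* con (+ 1)))
          :+ J₁ :* (C₀ :* (U :* con (+ 1)))
          :+ con (+ 0) :* (con (+ 0) :* (C₀ :* (U :* con (+ 1)))))
          :+ (:- (C₀ :* u :* U) :* (M :+ qm :* S)
          :+ (:- (C₀ :* U :* S) :* con (+ 1)
          :+ U :* :- (J₁ :* C₀))))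
      refl [ m ] [ suc (i ℕ.+ m) ] [ suc i ] [ 1 ] (coef 0 i) (qi ^^ m) ((qi ^^ m) ^^ i) (q ^^ m))
  -- With F and G the falling products of i + m of lengths j and j + 1, all terms involve only F, G
  -- and N = [i+m+1]; the first relation ties G to F.
  three-term (suc j) m (suc i) = by-relation
    (+-cong (*-congˡ (fall-last-suc (i ℕ.+ m) j))
      (+-cong (*-congˡ (qint-suc[i+m] i m))
      (+-cong (*-congˡ (coef-derivative j i))
      (+-cong (*-congˡ (q^^*qi^^ m)) (*-congˡ (coef-derivative (suc j) i))))))
    (solve 14 (λ M N S J J₁ C₀ C₁ D F G u U qm qj →
        M :* (C₁ :* (u :* U :* (N :* F)) :- u :* (C₀ :* (U :* G)))
          :+ ((u :* U :* C₁ :* N :+ U :* J :* D) :* (G :* qj)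
          :+ (u :* U :* (C₁ :* N :* F :- C₀ :* G) :* N
          :+ ((u :* U :* N :* F :* qm :- U :* G :* qj) :* (S :* C₁)
          :+ (:- (U :* N :* F :* J :* D :+ C₀ :* U :* G :* S) :* (qm :* u)
          :+ U :* G :* (S :* (qj :* C₁ :- C₀))))))
     := ((qj :* C₁ :- C₀) :* (u :* U :* (N :* G)) :+ J :* (C₁ :* (u :* U :* (N :* F)))
          :+ J₁ :* (C₀ :* (U :* G)) :+ J :* (J :* (D :* (U :* F))))
          :+ ((u :* U :* C₁ :* N :+ U :* J :* D) :* (F :* (N :- J))
          :+ (u :* U :* (C₁ :* N :* F :- C₀ :* G) :* (M :+ qm :* S)
          :+ ((u :* U :* N :* F :* qm :- U :* G :* qj) :* :- (J :* D)
          :+ (:- (U :* N :* F :* J :* D :+ C₀ :* U :* G :* S) :* con (+ 1)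
          :+ U :* G :* :- (J₁ :* C₀))))))
      refl [ m ] [ suc (i ℕ.+ m) ] [ suc i ] [ suc j ] [ suc (suc j) ] (coef (suc j) i)
      (coef (suc j) (suc i)) (coef j i) (fall (i ℕ.+ m) j) (fall (i ℕ.+ m) (suc j))
      (qi ^^ m) ((qi ^^ m) ^^ i) (q ^^ m) (q ^^ suc j))

  shift-cong : ∀ {f g : Grid} → (∀ m i → f m i ≈ g m i) → ∀ m i → shift f m i ≈ shift g m i
  shift-cong f≈g m zero    = refl
  shift-cong f≈g m (suc i) = f≈g m i

  shift-comb : ∀ s t r (A B C D : Grid) m i →
    shift (λ m i → A m i + s * B m i + t * C m i + r * (r * D m i)) m i ≈
    shift A m i + s * shift B m i + t * shift C m i + r * (r * shift D m i)
  shift-comb s t r A B C D m zero =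
    solve 3 (λ s t r → con (+ 0) := con (+ 0) :+ s :* con (+ 0) :+ t :* con (+ 0) :+ r :* (r :* con (+ 0)))
      refl s t r
  shift-comb s t r A B C D m (suc i) = refl

  shift-mulX : ∀ f m i → shift (mulX f) m i ≈ mulX (shift f) m i
  shift-mulX f m zero    =
    solve 2 (λ a u → con (+ 0) := a :* (con (+ 0) :- u :* con (+ 0))) refl [ m ] (qi ^^ m)
  shift-mulX f m (suc i) = refl

  x^_·orth_ : ℕ → ℕ → Grid
  x^ zero  ·orth j = orth j
  x^ suc n ·orth j = mulX (x^ n ·orth j)

  -- Multiplication by X is linear and commutes with multiplication by y, so the three-term relation
  -- survives any number of multiplications by X.
  recurrence : ∀ n j m i → (x^ suc n ·orth j) m i ≈
    (x^ n ·orth suc j) m i + [ j ] * (x^ n ·orth j) m i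
      + [ suc j ] * shift (x^ n ·orth j) m i + [ j ] * ([ j ] * shift (x^ n ·orth pred j) m i)
  recurrence zero    j m i = three-term j m i
  recurrence (suc n) j m i = begin
    [ m ] * ((x^ suc n ·orth j) m i - qi ^^ m * shift (x^ suc n ·orth j) m i)
      ≈⟨ *-congˡ (+-cong (recurrence n j m i) (-‿cong (*-congˡ
           (trans (shift-cong (recurrence n j) m i) (shift-comb [ j ] [ suc j ] [ j ] A B (shift B) (shift D) m i))))) ⟩
    [ m ] * ((A m i + [ j ] * B m i + [ suc j ] * shift B m i + [ j ] * ([ j ] * shift D m i))
      - qi ^^ m * (shift A m i + [ j ] * shift B m i + [ suc j ] * shift (shift B) m i
                     + [ j ] * ([ j ] * shift (shift D) m i)))
      ≈⟨ solve 11 (λ M u J J₁ a b c a′ c′ d d′ →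
             M :* ((a :+ J :* b :+ J₁ :* c :+ J :* (J :* d)) :- u :* (a′ :+ J :* c :+ J₁ :* c′ :+ J :* (J :* d′)))
          := M :* (a :- u :* a′) :+ J :* (M :* (b :- u :* c)) :+ J₁ :* (M :* (c :- u :* c′))
               :+ J :* (J :* (M :* (d :- u :* d′))))
           refl [ m ] (qi ^^ m) [ j ] [ suc j ] (A m i) (B m i) (shift B m i) (shift A m i) (shift (shift B) m i)
           (shift D m i) (shift (shift D) m i) ⟩
    mulX A m i + [ j ] * mulX B m i + [ suc j ] * mulX (shift B) m i + [ j ] * ([ j ] * mulX (shift D) m i)
      ≈⟨ +-cong (+-congˡ (*-congˡ (shift-mulX B m i))) (*-congˡ (*-congˡ (shift-mulX D m i))) ⟨
    mulX A m i + [ j ] * mulX B m i + [ suc j ] * shift (mulX B) m i + [ j ] * ([ j ] * shift (mulX D) m i) ∎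
    where
    A B D : Grid
    A = x^ n ·orth suc j
    B = x^ n ·orth j
    D = x^ n ·orth pred j

  -- The moment functional.

  w v : ℕ → Carrier
  w m = q^ (+ m ℤ.- + m ℤ.* + m)
  v m = q^ (ℤ.- + m ℤ.- + m ℤ.* + m)

  -- Multiplication by the mass at x_m without its factor y^m.
  weighted : Grid → Grid
  weighted f m i = w m * f m i - v m * shift f m i

  -- The result is a series in y. The omitted factor y^m moves the coefficient of y^i to y^(m+i),
  -- hence the sum along a diagonal.
  L : Grid → Series
  L f k = sumTo (suc k) (λ i → weighted f (k ∸ i) i)

  L-cong : ∀ {f g : Grid} → (∀ m i → f m i ≈ g m i) → ∀ k → L f k ≈ L g k
  L-cong f≈g k = sumTo-cong (suc k) (λ i →
    +-cong (*-congˡ (f≈g (k ∸ i) i)) (-‿cong (*-congˡ (shift-cong f≈g (k ∸ i) i))))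

  L-comb : ∀ s t r (A B C D : Grid) k →
    L (λ m i → A m i + s * B m i + t * C m i + r * (r * D m i)) k ≈
    L A k + s * L B k + t * L C k + r * (r * L D k)
  L-comb s t r A B C D k = trans
    (sumTo-cong (suc k) (λ i → trans
      (+-congˡ (-‿cong (*-congˡ (shift-comb s t r A B C D (k ∸ i) i))))
      (solve 13 (λ s t r w v a b c d a′ b′ c′ d′ →
          w :* (a :+ s :* b :+ t :* c :+ r :* (r :* d)) :- v :* (a′ :+ s :* b′ :+ t :* c′ :+ r :* (r :* d′))
       := (w :* a :- v :* a′) :+ s :* (w :* b :- v :* b′) :+ t :* (w :* c :- v :* c′)
            :+ r :* (r :* (w :* d :- v :* d′)))
        refl s t r (w (k ∸ i)) (v (k ∸ i)) (A (k ∸ i) i) (B (k ∸ i) i) (C (k ∸ i) i) (D (k ∸ i) i)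
        (shift A (k ∸ i) i) (shift B (k ∸ i) i) (shift C (k ∸ i) i) (shift D (k ∸ i) i))))
    (sumTo-comb (suc k) s t r _ _ _ _)

  -- `L` is linear over y; `x·_` acts here on series in y.
  L-shift : ∀ f k → L (shift f) k ≈ (x· L f) k
  L-shift f zero    =
    solve 2 (λ a b → con (+ 0) :+ (a :* con (+ 0) :- b :* con (+ 0)) := con (+ 0)) refl (w 0) (v 0)
  L-shift f (suc k) = trans (sumTo-head (suc k) _)
    (solve 3 (λ a b s → (a :* con (+ 0) :- b :* con (+ 0)) :+ s := s) refl (w (suc k)) (v (suc k)) (L f k))

  moment : ℕ → ℕ → Series
  moment n j = L (x^ n ·orth j)

  moment-suc : ∀ n j k → moment (suc n) j k ≈
    moment n (suc j) k + [ j ] * moment n j k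
      + [ suc j ] * (x· moment n j) k + [ j ] * ([ j ] * (x· moment n (pred j)) k)
  moment-suc n j k = begin
    L (x^ suc n ·orth j) k
      ≈⟨ L-cong (recurrence n j) k ⟩
    L (λ m i → (x^ n ·orth suc j) m i + [ j ] * (x^ n ·orth j) m i
      + [ suc j ] * shift (x^ n ·orth j) m i + [ j ] * ([ j ] * shift (x^ n ·orth pred j) m i)) k
      ≈⟨ L-comb [ j ] [ suc j ] [ j ] _ _ _ _ k ⟩
    moment n (suc j) k + [ j ] * moment n j k
      + [ suc j ] * L (shift (x^ n ·orth j)) k + [ j ] * ([ j ] * L (shift (x^ n ·orth pred j)) k)
      ≈⟨ +-cong (+-congˡ (*-congˡ (L-shift _ k))) (*-congˡ (*-congˡ (L-shift _ k))) ⟩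
    moment n (suc j) k + [ j ] * moment n j k
      + [ suc j ] * (x· moment n j) k + [ j ] * ([ j ] * (x· moment n (pred j)) k) ∎

  -- The sum stops at i = k and may miss coefficients when j > k, but then the prefactor is zero.
  fall*coef-sum : ∀ j k z → fall k j * sumTo (suc k) (λ i → coef j i * z ^^ i) ≈ fall k j * qprod j z
  fall*coef-sum j k z with j ℕₚ.≤? k
  ... | yes j≤k = *-congˡ (coef-sum j (suc k) z (s≤s j≤k))
  ... | no  j≰k = trans (*-congʳ k<j) (trans (zeroˡ _) (sym (trans (*-congʳ k<j) (zeroˡ _))))
    where
    k<j : fall k j ≈ 0#
    k<j = fall-vanish k j (ℕₚ.≰⇒> j≰k)


  -- Along a diagonal the powers of q become a constant times the i-th power of q^K. The other half
  -- of the mass gives the same constant with q^(K+1), which is what makes the two halves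
  -- comparable.
  weight-w : ∀ i m K → i ℕ.+ m ≡ suc K →
    w m * (qi ^^ m) ^^ i ≈ q^ (ℤ.- (+ suc K ℤ.* + K)) * (q ^^ K) ^^ i
  weight-w i m K h = begin
    w m * (qi ^^ m) ^^ i                            ≈⟨ *-congˡ (qi^^^^ m i) ⟩
    w m * q^ (ℤ.- (+ m ℤ.* + i))                    ≈⟨ q^-+ (+ m ℤ.- + m ℤ.* + m) (ℤ.- (+ m ℤ.* + i)) ⟨
    q^ (+ m ℤ.- + m ℤ.* + m ℤ.+ ℤ.- (+ m ℤ.* + i))  ≡⟨ ≡.cong q^ (exponent-w (+ i) (+ m) (+ K) (≡.cong +_ h)) ⟩
    q^ (ℤ.- (+ suc K ℤ.* + K) ℤ.+ + K ℤ.* + i)      ≈⟨ q^-+ (ℤ.- (+ suc K ℤ.* + K)) _ ⟩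
    q^ (ℤ.- (+ suc K ℤ.* + K)) * q^ (+ K ℤ.* + i)   ≈⟨ *-congˡ (q^^^^ K i) ⟨
    q^ (ℤ.- (+ suc K ℤ.* + K)) * (q ^^ K) ^^ i      ∎

  weight-v : ∀ i m K → i ℕ.+ m ≡ K →
    v m * (qi ^^ m) ^^ i ≈ q^ (ℤ.- (+ suc K ℤ.* + K)) * (q ^^ suc K) ^^ i
  weight-v i m K h = begin
    v m * (qi ^^ m) ^^ i                                 ≈⟨ *-congˡ (qi^^^^ m i) ⟩
    v m * q^ (ℤ.- (+ m ℤ.* + i))                         ≈⟨ q^-+ (ℤ.- + m ℤ.- + m ℤ.* + m) _ ⟨
    q^ (ℤ.- + m ℤ.- + m ℤ.* + m ℤ.+ ℤ.- (+ m ℤ.* + i))   ≡⟨ ≡.cong q^ (exponent-v (+ i) (+ m) (+ K) (≡.cong +_ h)) ⟩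
    q^ (ℤ.- (+ suc K ℤ.* + K) ℤ.+ + suc K ℤ.* + i)       ≈⟨ q^-+ (ℤ.- (+ suc K ℤ.* + K)) _ ⟩
    q^ (ℤ.- (+ suc K ℤ.* + K)) * q^ (+ suc K ℤ.* + i)    ≈⟨ *-congˡ (q^^^^ (suc K) i) ⟨
    q^ (ℤ.- (+ suc K ℤ.* + K)) * (q ^^ suc K) ^^ i       ∎

  weight-Ê : ∀ i m k → i ℕ.+ m ≡ k →
    w m * (qi ^^ m) ^^ i ≈ q^ (+ k ℤ.- + (k ℕ.* k)) * (q^ (+ (k ℕ.* i) ℤ.- + k) * q ^^ m)
  weight-Ê i m k h = begin
    w m * (qi ^^ m) ^^ i
      ≈⟨ *-congˡ (qi^^^^ m i) ⟩
    w m * q^ (ℤ.- (+ m ℤ.* + i))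
      ≈⟨ q^-+ (+ m ℤ.- + m ℤ.* + m) (ℤ.- (+ m ℤ.* + i)) ⟨
    q^ (+ m ℤ.- + m ℤ.* + m ℤ.+ ℤ.- (+ m ℤ.* + i))
      ≡⟨ ≡.cong q^ (exponent-Ê (+ i) (+ m) (+ k) (≡.cong +_ h)) ⟩
    q^ ((+ k ℤ.- + k ℤ.* + k) ℤ.+ ((+ k ℤ.* + i ℤ.- + k) ℤ.+ + m))
      ≈⟨ trans (q^-+ (+ k ℤ.- + k ℤ.* + k) _) (*-congˡ (q^-+ (+ k ℤ.* + i ℤ.- + k) (+ m))) ⟩
    q^ (+ k ℤ.- + k ℤ.* + k) * (q^ (+ k ℤ.* + i ℤ.- + k) * q ^^ m)
      ≡⟨ ≡.cong₂ (λ a b → q^ (+ k ℤ.- a) * (q^ (b ℤ.- + k) * q ^^ m)) (≡.sym (ℤₚ.pos-* k k)) (≡.sym (ℤₚ.pos-* k i)) ⟩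
    q^ (+ k ℤ.- + (k ℕ.* k)) * (q^ (+ (k ℕ.* i) ℤ.- + k) * q ^^ m) ∎

  weight-Ê′ : ∀ i m k → suc i ℕ.+ m ≡ k →
    v m * (qi ^^ m) ^^ i ≈ q^ (+ k ℤ.- + (k ℕ.* k)) * q^ (+ (k ℕ.* suc i) ℤ.- + k)
  weight-Ê′ i m k h = begin
    v m * (qi ^^ m) ^^ i
      ≈⟨ *-congˡ (qi^^^^ m i) ⟩
    v m * q^ (ℤ.- (+ m ℤ.* + i))
      ≈⟨ q^-+ (ℤ.- + m ℤ.- + m ℤ.* + m) _ ⟨
    q^ (ℤ.- + m ℤ.- + m ℤ.* + m ℤ.+ ℤ.- (+ m ℤ.* + i))
      ≡⟨ ≡.cong q^ (exponent-Ê′ (+ i) (+ m) (+ k) (≡.cong +_ h)) ⟩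
    q^ ((+ k ℤ.- + k ℤ.* + k) ℤ.+ (+ k ℤ.* + suc i ℤ.- + k))
      ≈⟨ q^-+ (+ k ℤ.- + k ℤ.* + k) _ ⟩
    q^ (+ k ℤ.- + k ℤ.* + k) * q^ (+ k ℤ.* + suc i ℤ.- + k)
      ≡⟨ ≡.cong₂ (λ a b → q^ (+ k ℤ.- a) * q^ (b ℤ.- + k)) (≡.sym (ℤₚ.pos-* k k)) (≡.sym (ℤₚ.pos-* k (suc i))) ⟩
    q^ (+ k ℤ.- + (k ℕ.* k)) * q^ (+ (k ℕ.* suc i) ℤ.- + k) ∎

  L-orth-0 : ∀ j → L (orth j) 0 ≈ one j
  L-orth-0 zero =
    solve 1 (λ a → con (+ 0) :+ (con (+ 1) :* (con (+ 1) :* (con (+ 1) :* con (+ 1))) :- a :* con (+ 0)) := con (+ 1))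
      refl (v 0)
  L-orth-0 (suc j) =
    solve 2 (λ a c → con (+ 0) :+ (con (+ 1) :* (c :* (con (+ 1) :* con (+ 0))) :- a :* con (+ 0)) := con (+ 0))
      refl (v 0) (coef (suc j) 0)

  -- The two halves of the mass evaluate the product at q^K and at q^(K+1), with prefactors
  -- `fall (suc K) j` and `fall K j`. By `qprod-fall` each evaluation supplies the other falling
  -- product, so the halves cancel. For j = 0 this is the telescoping of the total mass to 1.
  L-orth-suc : ∀ j K → L (orth j) (suc K) ≈ 0#
  L-orth-suc j K = begin
    sumTo (suc (suc K)) (λ i → w (suc K ∸ i) * orth j (suc K ∸ i) i - v (suc K ∸ i) * shift (orth j) (suc K ∸ i) i)
      ≈⟨ sumTo-+ (suc (suc K)) _ _ ⟩
    sumTo (suc (suc K)) (λ i → w (suc K ∸ i) * orth j (suc K ∸ i) i)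
      + sumTo (suc (suc K)) (λ i → - (v (suc K ∸ i) * shift (orth j) (suc K ∸ i) i))
      ≈⟨ +-cong
           (sumTo-cong< (suc (suc K)) (λ i i<k → term-w i (suc K ∸ i) (ℕₚ.m+[n∸m]≡n (ℕ.s≤s⁻¹ i<k))))
           -- The extra y in the second half removes i = 0 and lowers the diagonal from K + 1 to K.
           (trans (sumTo-head (suc K) _)
             (+-cong (solve 1 (λ a → :- (a :* con (+ 0)) := con (+ 0)) refl (v (suc K)))
               (sumTo-cong< (suc K) (λ i i<K → term-v i (K ∸ i) (ℕₚ.m+[n∸m]≡n (ℕ.s≤s⁻¹ i<K)))))) ⟩
    sumTo (suc (suc K)) (λ i → Q * (fall (suc K) j) * (coef j i * (q ^^ K) ^^ i))
      + (0# + sumTo (suc K) (λ i → - (Q * fall K j) * (coef j i * (q ^^ suc K) ^^ i)))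
      ≈⟨ +-cong (sumTo-*ˡ (suc (suc K)) _ _) (+-congˡ (sumTo-*ˡ (suc K) _ _)) ⟩
    Q * fall (suc K) j * S₁ + (0# + - (Q * fall K j) * S₂)
      ≈⟨ solve 5 (λ Q f g s t → Q :* f :* s :+ (con (+ 0) :+ :- (Q :* g) :* t) := Q :* (f :* s :- g :* t))
           refl Q (fall (suc K) j) (fall K j) S₁ S₂ ⟩
    Q * (fall (suc K) j * S₁ - fall K j * S₂)
      ≈⟨ *-congˡ (+-cong
           (trans (fall*coef-sum j (suc K) (q ^^ K)) (*-congˡ (qprod-fall j K)))
           (-‿cong (trans (fall*coef-sum j K (q ^^ suc K)) (*-congˡ (qprod-fall j (suc K)))))) ⟩
    Q * (fall (suc K) j * (qfactor j * fall K j) - fall K j * (qfactor j * fall (suc K) j))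
      ≈⟨ solve 4 (λ Q f g r → Q :* (f :* (r :* g) :- g :* (r :* f)) := con (+ 0))
           refl Q (fall (suc K) j) (fall K j) (qfactor j) ⟩
    0# ∎
    where
    Q S₁ S₂ : Carrier
    Q  = q^ (ℤ.- (+ suc K ℤ.* + K))
    S₁ = sumTo (suc (suc K)) (λ i → coef j i * (q ^^ K) ^^ i)
    S₂ = sumTo (suc K) (λ i → coef j i * (q ^^ suc K) ^^ i)

    term-w : ∀ i m → i ℕ.+ m ≡ suc K →
      w m * orth j m i ≈ Q * fall (suc K) j * (coef j i * (q ^^ K) ^^ i)
    term-w i m h = begin
      w m * (coef j i * ((qi ^^ m) ^^ i * fall (i ℕ.+ m) j))
        ≈⟨ solve 4 (λ a b c d → a :* (b :* (c :* d)) := a :* c :* (b :* d)) refl (w m) (coef j i) _ _ ⟩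
      w m * (qi ^^ m) ^^ i * (coef j i * fall (i ℕ.+ m) j)
        ≈⟨ *-cong (weight-w i m K h) (reflexive (≡.cong (λ k → coef j i * fall k j) h)) ⟩
      Q * (q ^^ K) ^^ i * (coef j i * fall (suc K) j)
        ≈⟨ solve 4 (λ a b c d → a :* b :* (c :* d) := a :* d :* (c :* b)) refl Q _ (coef j i) _ ⟩
      Q * fall (suc K) j * (coef j i * (q ^^ K) ^^ i) ∎

    term-v : ∀ i m → i ℕ.+ m ≡ K →
      - (v m * orth j m i) ≈ - (Q * fall K j) * (coef j i * (q ^^ suc K) ^^ i)
    term-v i m h = begin
      - (v m * (coef j i * ((qi ^^ m) ^^ i * fall (i ℕ.+ m) j)))
        ≈⟨ solve 4 (λ a b c d → :- (a :* (b :* (c :* d))) := :- (a :* c :* (b :* d))) refl (v m) (coef j i) _ _ ⟩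
      - (v m * (qi ^^ m) ^^ i * (coef j i * fall (i ℕ.+ m) j))
        ≈⟨ -‿cong (*-cong (weight-v i m K h) (reflexive (≡.cong (λ k → coef j i * fall k j) h))) ⟩
      - (Q * (q ^^ suc K) ^^ i * (coef j i * fall K j))
        ≈⟨ solve 4 (λ a b c d → :- (a :* b :* (c :* d)) := :- (a :* d) :* (c :* b)) refl Q _ (coef j i) _ ⟩
      - (Q * fall K j) * (coef j i * (q ^^ suc K) ^^ i) ∎

  -- Each multiplication by X raises the degree in y by at most one, starting from constants.
  moment-degree : ∀ n j k → n < k → moment n j k ≈ 0#
  moment-degree zero    j (suc K) _         = L-orth-suc j K
  moment-degree (suc n) j (suc k) (s≤s n<k) = begin
    moment (suc n) j (suc k)
      ≈⟨ moment-suc n j (suc k) ⟩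
    moment n (suc j) (suc k) + [ j ] * moment n j (suc k)
      + [ suc j ] * moment n j k + [ j ] * ([ j ] * moment n (pred j) k)
      ≈⟨ +-cong (+-cong (+-cong (moment-degree n (suc j) (suc k) n<1+k) (*-congˡ (moment-degree n j (suc k) n<1+k)))
           (*-congˡ (moment-degree n j k n<k))) (*-congˡ (*-congˡ (moment-degree n (pred j) k n<k))) ⟩
    0# + [ j ] * 0# + [ suc j ] * 0# + [ j ] * ([ j ] * 0#)
      ≈⟨ solve 2 (λ a b → con (+ 0) :+ a :* con (+ 0) :+ b :* con (+ 0) :+ a :* (a :* con (+ 0)) := con (+ 0))
           refl [ j ] [ suc j ] ⟩
    0# ∎
    where
    n<1+k : n < suc k
    n<1+k = ℕₚ.m<n⇒m<1+n n<k

  -- Substituting the ring element for y.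

  evaluate : ℕ → Series → Carrier
  evaluate n f = sumTo n (λ k → f k * y ^^ k)

  evaluate-x· : ∀ n f → evaluate (suc n) (x· f) ≈ y * evaluate n f
  evaluate-x· n f = begin
    evaluate (suc n) (x· f)
      ≈⟨ sumTo-head n _ ⟩
    0# * 1# + sumTo n (λ k → f k * (y * y ^^ k))
      ≈⟨ +-cong (zeroˡ 1#) (sumTo-cong n (λ k →
           solve 3 (λ a b c → a :* (b :* c) := b :* (a :* c)) refl (f k) y (y ^^ k))) ⟩
    0# + sumTo n (λ k → y * (f k * y ^^ k))
      ≈⟨ trans (+-identityˡ _) (sumTo-*ˡ n y _) ⟩
    y * evaluate n f ∎

  -- The recurrence compares moments whose cuts differ by one; the additional coefficient lies
  -- beyond the degree.
  evaluate-moment : ∀ n j → evaluate (suc (suc n)) (moment n j) ≈ evaluate (suc n) (moment n j)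
  evaluate-moment n j =
    trans (+-congˡ (trans (*-congʳ (moment-degree n j (suc n) (ℕₚ.n<1+n n))) (zeroˡ _))) (+-identityʳ _)

  motzkin : ℕ → ℕ → Carrier
  motzkin n j = evaluate (suc n) (moment n j)

  motzkin-zero : ∀ j → motzkin 0 j ≈ one j
  motzkin-zero j = trans (+-identityˡ _) (trans (*-identityʳ _) (L-orth-0 j))

  motzkin-suc : ∀ n j → motzkin (suc n) j ≈
    motzkin n (suc j) + bcf 1# q y j * motzkin n j + lcf 1# q y j * motzkin n (pred j)
  motzkin-suc n j = begin
    evaluate N (moment (suc n) j)
      ≈⟨ sumTo-cong N (λ k → trans (*-congʳ (moment-suc n j k))
           (solve 7 (λ a b c d J J₁ z →
                (a :+ J :* b :+ J₁ :* c :+ J :* (J :* d)) :* z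
             := a :* z :+ J :* (b :* z) :+ J₁ :* (c :* z) :+ J :* (J :* (d :* z)))
             refl (moment n (suc j) k) (moment n j k) ((x· moment n j) k) ((x· moment n (pred j)) k)
             [ j ] [ suc j ] (y ^^ k))) ⟩
    sumTo N (λ k → moment n (suc j) k * y ^^ k + [ j ] * (moment n j k * y ^^ k)
      + [ suc j ] * ((x· moment n j) k * y ^^ k) + [ j ] * ([ j ] * ((x· moment n (pred j)) k * y ^^ k)))
      ≈⟨ sumTo-comb N [ j ] [ suc j ] [ j ] _ _ _ _ ⟩
    evaluate N (moment n (suc j)) + [ j ] * evaluate N (moment n j)
      + [ suc j ] * evaluate N (x· moment n j) + [ j ] * ([ j ] * evaluate N (x· moment n (pred j)))
      ≈⟨ +-cong (+-cong (+-cong (evaluate-moment n (suc j)) (*-congˡ (evaluate-moment n j)))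
           (*-congˡ (evaluate-x· (suc n) _))) (*-congˡ (*-congˡ (evaluate-x· (suc n) _))) ⟩
    motzkin n (suc j) + [ j ] * motzkin n j + [ suc j ] * (y * motzkin n j) + [ j ] * ([ j ] * (y * motzkin n (pred j)))
      ≈⟨ solve 6 (λ a b c J J₁ y →
              a :+ J :* b :+ J₁ :* (y :* b) :+ J :* (J :* (y :* c))
           := a :+ (y :* J₁ :+ J) :* b :+ (y :* (J :* J)) :* c)
           refl (motzkin n (suc j)) (motzkin n j) (motzkin n (pred j)) [ j ] [ suc j ] y ⟩
    motzkin n (suc j) + bcf 1# q y j * motzkin n j + lcf 1# q y j * motzkin n (pred j) ∎
    where
    N : ℕ
    N = suc (suc n)

  -- The moments of X^n are the numbers Ê.

  fromℕ-+ : ∀ m n → fromℕ (m ℕ.+ n) ≈ fromℕ m + fromℕ n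
  fromℕ-+ zero    n = sym (+-identityˡ _)
  fromℕ-+ (suc m) n = trans (+-congˡ (fromℕ-+ m n)) (sym (+-assoc _ _ _))

  fromℕ-choose : ∀ n i → fromℕ (choose (suc n) i) ≈ fromℕ (choose n i) + binomPrev n i
  fromℕ-choose n zero    = sym (+-identityʳ _)
  fromℕ-choose n (suc i) = trans
    (reflexive (≡.cong fromℕ (≡.sym (nCk+nC[k+1]≡[n+1]C[k+1] n i))))
    (trans (fromℕ-+ (choose n i) _) (+-comm _ _))

  power : ℕ → Grid
  power n m i = [ m ] ^^ n * ((- 1#) ^^ i * (fromℕ (choose n i) * (qi ^^ m) ^^ i))

  x^n·orth0 : ∀ n m i → (x^ n ·orth 0) m i ≈ power n m i
  x^n·orth0 zero m zero =
    solve 0 (con (+ 1) :* (con (+ 1) :* con (+ 1)) := con (+ 1) :* (con (+ 1) :* ((con (+ 1) :+ con (+ 0)) :* con (+ 1)))) refl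
  x^n·orth0 zero m (suc i) =
    solve 2 (λ a b → con (+ 0) :* (a :* con (+ 1)) := con (+ 1) :* (b :* (con (+ 0) :* a))) refl
      ((qi ^^ m) ^^ suc i) ((- 1#) ^^ suc i)
  x^n·orth0 (suc n) m zero = begin
    [ m ] * ((x^ n ·orth 0) m 0 - qi ^^ m * 0#)
      ≈⟨ *-congˡ (+-congʳ (x^n·orth0 n m 0)) ⟩
    [ m ] * (power n m 0 - qi ^^ m * 0#)
      ≈⟨ solve 4 (λ a b c u → a :* (b :* (con (+ 1) :* (c :* con (+ 1))) :- u :* con (+ 0))
                := a :* b :* (con (+ 1) :* (c :* con (+ 1)))) refl [ m ] ([ m ] ^^ n) (fromℕ (choose n 0)) (qi ^^ m) ⟩
    power (suc n) m 0 ∎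
  x^n·orth0 (suc n) m (suc i) = begin
    [ m ] * ((x^ n ·orth 0) m (suc i) - qi ^^ m * (x^ n ·orth 0) m i)
      ≈⟨ *-congˡ (+-cong (x^n·orth0 n m (suc i)) (-‿cong (*-congˡ (x^n·orth0 n m i)))) ⟩
    [ m ] * (power n m (suc i) - qi ^^ m * power n m i)
      ≈⟨ solve 7 (λ a b s c d u U →
             a :* (b :* (:- con (+ 1) :* s :* (c :* (u :* U))) :- u :* (b :* (s :* (d :* U))))
          := a :* b :* (:- con (+ 1) :* s :* ((c :+ d) :* (u :* U))))
          refl [ m ] ([ m ] ^^ n) ((- 1#) ^^ i) (fromℕ (choose n (suc i))) (fromℕ (choose n i)) (qi ^^ m) ((qi ^^ m) ^^ i) ⟩
    [ m ] ^^ suc n * ((- 1#) ^^ suc i * ((fromℕ (choose n (suc i)) + fromℕ (choose n i)) * (qi ^^ m) ^^ suc i))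
      ≈⟨ *-congˡ (*-congˡ (*-congʳ (fromℕ-choose n (suc i)))) ⟨
    power (suc n) m (suc i) ∎

  Êterm : ℕ → ℕ → ℕ → ℕ → Carrier
  Êterm n k m i = (- 1#) ^^ i * ([ m ] ^^ n *
    (q^ (+ (k ℕ.* i) ℤ.- + k) * (fromℕ (choose n i) * q ^^ m + binomPrev n i)))

  -- The half `w` of the mass yields the binomial with the factor q^m = q^(k-i), the half `v` yields
  -- the preceding binomial; its minus sign is absorbed by lowering the index of (-1)^i.
  weighted-power : ∀ n k i m → i ℕ.+ m ≡ k →
    weighted (power n) m i ≈ q^ (+ k ℤ.- + (k ℕ.* k)) * Êterm n k m i
  weighted-power n k zero m h = by-relation (*-congˡ (sym (weight-Ê 0 m k h)))
    (solve 7 (λ w v M B Z Z′ qm →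
        w :* (M :* (con (+ 1) :* (B :* con (+ 1)))) :- v :* con (+ 0) :+ M :* B :* (Z :* (Z′ :* qm))
     := Z :* (con (+ 1) :* (M :* (Z′ :* (B :* qm :+ con (+ 0))))) :+ M :* B :* (w :* con (+ 1)))
     refl (w m) (v m) ([ m ] ^^ n) (fromℕ (choose n 0)) (q^ (+ k ℤ.- + (k ℕ.* k))) (q^ (+ (k ℕ.* 0) ℤ.- + k)) (q ^^ m))
  weighted-power n k (suc i) m h = by-relation
    (+-cong (*-congˡ (sym (weight-Ê (suc i) m k h))) (*-congˡ (sym (weight-Ê′ i m k h))))
    (solve 11 (λ w v M B B′ Z Z′ qm s u U →
        w :* (M :* (:- con (+ 1) :* s :* (B :* (u :* U)))) :- v :* (M :* (s :* (B′ :* U)))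
          :+ (:- con (+ 1) :* s :* M :* B :* (Z :* (Z′ :* qm)) :+ :- con (+ 1) :* s :* M :* B′ :* (Z :* Z′))
     := Z :* (:- con (+ 1) :* s :* (M :* (Z′ :* (B :* qm :+ B′))))
          :+ (:- con (+ 1) :* s :* M :* B :* (w :* (u :* U)) :+ :- con (+ 1) :* s :* M :* B′ :* (v :* U)))
     refl (w m) (v m) ([ m ] ^^ n) (fromℕ (choose n (suc i))) (fromℕ (choose n i)) (q^ (+ k ℤ.- + (k ℕ.* k)))
     (q^ (+ (k ℕ.* suc i) ℤ.- + k)) (q ^^ m) ((- 1#) ^^ i) (qi ^^ m) ((qi ^^ m) ^^ i))

  -- The term i = k of the sum for L, absent from Ê, carries the factor [0]^n.
  moment≈Ehat : ∀ n k → moment (suc n) 0 k ≈ Ehat q qi k (suc n)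
  moment≈Ehat n k = begin
    sumTo (suc k) (λ i → weighted (x^ suc n ·orth 0) (k ∸ i) i)
      ≈⟨ L-cong (x^n·orth0 (suc n)) k ⟩
    sumTo (suc k) (λ i → weighted (power (suc n)) (k ∸ i) i)
      ≈⟨ sumTo-cong< (suc k) (λ i i<1+k →
           weighted-power (suc n) k i (k ∸ i) (ℕₚ.m+[n∸m]≡n (ℕ.s≤s⁻¹ i<1+k))) ⟩
    sumTo (suc k) (λ i → Z * Êterm (suc n) k (k ∸ i) i)
      ≈⟨ sumTo-*ˡ (suc k) Z _ ⟩
    Z * (sumTo k (λ i → Êterm (suc n) k (k ∸ i) i) + Êterm (suc n) k (k ∸ k) k)
      ≈⟨ *-congˡ (trans (+-congˡ last-term) (+-identityʳ _)) ⟩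
    Z * sumTo k (λ i → Êterm (suc n) k (k ∸ i) i) ∎
    where
    Z : Carrier
    Z = q^ (+ k ℤ.- + (k ℕ.* k))

    last-term : Êterm (suc n) k (k ∸ k) k ≈ 0#
    last-term = trans (reflexive (≡.cong (λ m → Êterm (suc n) k m k) (ℕₚ.n∸n≡0 k)))
      (solve 3 (λ a b c → a :* (con (+ 0) :* b :* c) := con (+ 0)) refl _ _ _)

  EhatSeries≈motzkin : ∀ n → EhatSeries q qi y n ≈ motzkin n 0
  EhatSeries≈motzkin zero    = sym (motzkin-zero 0)
  EhatSeries≈motzkin (suc n) = sym (begin
    motzkin (suc n) 0
      ≈⟨ sumTo-cong (suc (suc n)) (λ k → *-congʳ (moment≈Ehat n k)) ⟩
    sumTo (suc (suc n)) (λ k → Ehat q qi k (suc n) * y ^^ k)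
      ≈⟨ sumTo-head (suc n) _ ⟩
    -- At k = 0 the sum defining Ê is empty, which matches the series in y starting at k = 1.
    Ehat q qi 0 (suc n) * 1# + EhatSeries q qi y (suc n)
      ≈⟨ +-congʳ (solve 0 (con (+ 1) :* con (+ 0) :* con (+ 1) := con (+ 0)) refl) ⟩
    0# + EhatSeries q qi y (suc n)
      ≈⟨ +-identityˡ _ ⟩
    EhatSeries q qi y (suc n) ∎)

theorem2 : ∀ {c ℓ : Level} (R : CommutativeRing c ℓ) →
  let open CommutativeRing R
      open Series R
  in (q qi y : Carrier) → q * qi ≈ 1# → qi * q ≈ 1# →
     (n : ℕ) → EhatSeries q qi y n ≈ Fcf q 1# y n
theorem2 R q qi y q*qi≈1 _ n = trans (EhatSeries≈motzkin n) (Fcf-unique motzkin motzkin-zero motzkin-suc n)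
  where
  open CommutativeRing R using (trans; 1#)
  open Moments R q qi y q*qi≈1
  open ContinuedFraction R 1# q y
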